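{- Let $K$ be an absorptive, fully-continuous semiring. Let $\mathcal{E} \colon (X = P_X)_{X \in \mathbf{X}}$ be a polynomial equation system over $K$ and $\mathbf{X} = \{X_1,\dots,X_\ell\}$ with induced operator $F_\mathcal{E} \colon K^\ell \to K^\ell$. Then, \[ \mathrm{lfp}(F_\mathcal{E}) = F_\mathcal{E}^\ell(\mathbf{0}),\quad \mathrm{gfp}(F_\mathcal{E}) = F_\mathcal{E}^\ell\big( \, F_\mathcal{E}^\ell(\mathbf{1})^\infty \,\big). \]
   Context: A (commutative) semiring $(K,+,\cdot,0,1)$ with $0\neq 1$ is absorptive if $1+a=1$ for all $a$ (this implies idempotence). The natural order is $a \le b$ iff $a+b=b$. $K$ is fully continuous if $\le$ is a complete lattice and for all $a\in K$, all nonempty chains $C\subseteq K$ and $\circ\in\{+,\cdot\}$: $\sup(a\circ C)=a\circ\sup C$ and $\inf(a\circ C)=a\circ\inf C$ (suprema/infima w.r.t. the natural order). The infinitary power is $a^\infty := \inf_{n\in\mathbb{N}} a^n$ (infimum w.r.t. the natural order), applied componentwise to tuples. A polynomial equation system $\mathcal{E}$ over $K$ and indeterminates $\mathbf{X}=\{X_1,\dots,X_\ell\}$ is a family of equations $X_i = P_i(X_1,\dots,X_\ell)$, where each $P_i$ is a finite sum of terms $c\cdot m$ with pairwise different monomials $m$ over $\mathbf{X}$ (natural-number exponents) and coefficients $c\in K\setminus\{0\}$. The induced operator is $F_\mathcal{E}(a_1,\dots,a_\ell)_X = P_X(a_1,\dots,a_\ell)$; $\mathrm{lfp}$/$\mathrm{gfp}$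 denote its least/greatest fixed point w.r.t. the componentwise natural order, i.e. the least/greatest solution of $\mathcal{E}$. $\mathbf{0}=(0,\dots,0)$, $\mathbf{1}=(1,\dots,1)$, and $F^\ell$ is the $\ell$-fold application of $F$. -}

module Defs where

open import Level using (0ℓ)
open import Algebra.Bundles using (CommutativeSemiring)
open import Data.Nat using (ℕ; zero; suc)
open import Data.Fin using (Fin)
import Data.Fin as Fin
open import Data.Vec using (Vec; []; _∷_)
open import Data.List using (List; []; _∷_; map)
open import Data.List.Relation.Unary.Unique.Propositional using (Unique)
open import Data.Product using (_×_; _,_; ∃; proj₁; proj₂)
open import Data.Sum using (_⊎_)
open import Relation.Nullary using (¬_)
open import Data.List.Relation.Unary.Any using (Any)
open import Relation.Binary.PropositionalEquality using (_≡_)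

module _ (K : CommutativeSemiring 0ℓ 0ℓ) where
  open CommutativeSemiring K using (Carrier; _≈_; _+_; _*_; 0#; 1#)

  Subset : Set₁
  Subset = Carrier → Set

  _≤ₙ_ : Carrier → Carrier → Set
  a ≤ₙ b = (a + b) ≈ b

  pow : Carrier → ℕ → Carrier
  pow a zero = 1#
  pow a (suc n) = a * pow a n

  Absorptive : Set
  Absorptive = ¬ (0# ≈ 1#) × (∀ a → (1# + a) ≈ 1#)

  IsSup : Subset → Carrier → Set
  IsSup S s = (∀ x → S x → x ≤ₙ s) × (∀ u → (∀ x → S x → x ≤ₙ u) → s ≤ₙ u)

  IsInf : Subset → Carrier → Set
  IsInf S s = (∀ x → S x → s ≤ₙ x) × (∀ u → (∀ x → S x → u ≤ₙ x) → u ≤ₙ s)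

  IsCompleteLattice : Set₁
  IsCompleteLattice = (∀ S → ∃ λ s → IsSup S s) × (∀ S → ∃ λ s → IsInf S s)

  IsNonemptyChain : Subset → Set
  IsNonemptyChain C = (∃ λ x → C x) × (∀ x y → C x → C y → x ≤ₙ y ⊎ y ≤ₙ x)

  image : (Carrier → Carrier → Carrier) → Carrier → Subset → Subset
  image _∘_ a C x = ∃ λ c → C c × x ≈ (a ∘ c)

  ContinuousOp : (Carrier → Carrier → Carrier) → Set₁
  ContinuousOp _∘_ = ∀ a C → IsNonemptyChain C →
      (∀ s → IsSup C s → IsSup (image _∘_ a C) (a ∘ s))
    × (∀ s → IsInf C s → IsInf (image _∘_ a C) (a ∘ s))

  FullyContinuous : Set₁
  FullyContinuous = IsCompleteLattice × ContinuousOp _+_ × ContinuousOp _*_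

  IsInfPow : Carrier → Carrier → Set
  IsInfPow a b = IsInf (λ x → ∃ λ n → x ≈ pow a n) b

  Tuple : ℕ → Set
  Tuple ℓ = Fin ℓ → Carrier

  -- a monomial over X₁..X_ℓ is its exponent vector
  Monomial : ℕ → Set
  Monomial ℓ = Vec ℕ ℓ

  evalMon : ∀ {ℓ} → Monomial ℓ → Tuple ℓ → Carrier
  evalMon [] a = 1#
  evalMon (e ∷ es) a = pow (a Fin.zero) e * evalMon es (λ i → a (Fin.suc i))

  -- a polynomial: finite sum of terms c · m
  Polynomial : ℕ → Set
  Polynomial ℓ = List (Carrier × Monomial ℓ)

  evalPoly : ∀ {ℓ} → Polynomial ℓ → Tuple ℓ → Carrier
  evalPoly [] a = 0#
  evalPoly ((c , m) ∷ ts) a = (c * evalMon m a) + evalPoly ts a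

  WellFormedPoly : ∀ {ℓ} → Polynomial ℓ → Set
  WellFormedPoly P = (∀ c m → Any (λ t → t ≡ (c , m)) P → ¬ (c ≈ 0#))
                   × Unique (map proj₂ P)

  EquationSystem : ℕ → Set
  EquationSystem ℓ = Fin ℓ → Polynomial ℓ

  WellFormedSystem : ∀ {ℓ} → EquationSystem ℓ → Set
  WellFormedSystem E = ∀ i → WellFormedPoly (E i)

  Op : ∀ {ℓ} → EquationSystem ℓ → Tuple ℓ → Tuple ℓ
  Op E a i = evalPoly (E i) a

  iter : ∀ {ℓ} → (Tuple ℓ → Tuple ℓ) → ℕ → Tuple ℓ → Tuple ℓ
  iter F zero a = a
  iter F (suc n) a = F (iter F n a)

  zeros : ∀ {ℓ} → Tuple ℓ
  zeros _ = 0#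

  ones : ∀ {ℓ} → Tuple ℓ
  ones _ = 1#

  _≈ᵗ_ : ∀ {ℓ} → Tuple ℓ → Tuple ℓ → Set
  a ≈ᵗ b = ∀ i → a i ≈ b i

  _≤ᵗ_ : ∀ {ℓ} → Tuple ℓ → Tuple ℓ → Set
  a ≤ᵗ b = ∀ i → a i ≤ₙ b i

  IsFixedPoint : ∀ {ℓ} → (Tuple ℓ → Tuple ℓ) → Tuple ℓ → Set
  IsFixedPoint F x = F x ≈ᵗ x

  IsLeastFixedPoint : ∀ {ℓ} → (Tuple ℓ → Tuple ℓ) → Tuple ℓ → Set
  IsLeastFixedPoint F x = IsFixedPoint F x × (∀ y → IsFixedPoint F y → x ≤ᵗ y)

  IsGreatestFixedPoint : ∀ {ℓ} → (Tuple ℓ → Tuple ℓ) → Tuple ℓ → Set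
  IsGreatestFixedPoint F x = IsFixedPoint F x × (∀ y → IsFixedPoint F y → y ≤ᵗ x)

{-# OPTIONS --safe #-}

-- For an operator with F (x + s) ≤ F x + s, cutting a derivation tree at a repeated
-- variable only increases its value, so the iteration from the bottom element is
-- stationary after ℓ steps.  This gives the least fixed point.  Write a ≼ b for
-- a^∞ ≤ b; then * is a meet for ≼ and F x * s ≼ F (x * s), so the same argument for
-- the reversed order gives F^ℓ(1) ≼ F^(ℓ+1)(1), whence b = F^ℓ(1)^∞ satisfies b ≤ F b.
-- Applied to x ↦ F x + b, it shows that z = F^ℓ(b) is a fixed point.  To bound the
-- greatest solution g by z, variables are eliminated one at a time: g X satisfies an
-- affine inequality g X ≤ w + g X * p, hence g X ≤ w + p^∞, and p^∞ ≤ z X because the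
-- idempotent p^∞ lies below a postfixed point u, while u^∞ ≤ F^ℓ(1)^∞ = b ≤ z.
module Submission where

open import Defs
open import Level using (0ℓ)
open import Algebra.Bundles using (CommutativeSemiring)
import Algebra.Solver.Ring.NaturalCoefficients.Default as SemiringSolver
open import Data.Nat using (ℕ; zero; suc; z≤n)
import Data.Nat as ℕ
import Data.Nat.Properties as ℕₚ
open import Data.Fin using (Fin; _≟_)
import Data.Fin.Subset as Sub
import Data.Fin.Subset.Properties as Subₚ
open import Data.List using (List; []; _∷_; allFin)
open import Data.List.Membership.DecPropositional using (_∈?_)
open import Data.List.Membership.Propositional using (_∈_; _∉_)
open import Data.List.Membership.Propositional.Properties using (∈-allFin)
open import Data.List.Relation.Unary.Any using (here; there)
open import Data.Product using (_×_; _,_; ∃; proj₁; proj₂)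
open import Data.Sum using (_⊎_; inj₁; inj₂; [_,_]′)
open import Data.Vec using ([]; _∷_)
open import Function using (_∘_; flip)
open import Relation.Binary.Bundles using (Poset)
import Relation.Binary.Reasoning.PartialOrder as PosetReasoning
open import Relation.Binary.PropositionalEquality as ≡ using (_≡_)
open import Relation.Nullary using (yes; no; contradiction)

-- Stationarity of iterations from the bottom element.

module Stabilisation (K : CommutativeSemiring 0ℓ 0ℓ) where

  open CommutativeSemiring K using (Carrier)

  module _
    (_⊑_ : Carrier → Carrier → Set) (_∨_ : Carrier → Carrier → Carrier) (⊥ : Carrier)
    (⊑-refl : ∀ {a} → a ⊑ a) (⊑-trans : ∀ {a b c} → a ⊑ b → b ⊑ c → a ⊑ c)
    (inl : ∀ a b → a ⊑ (a ∨ b)) (inr : ∀ a b → b ⊑ (a ∨ b))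
    (lub : ∀ {a b c} → a ⊑ c → b ⊑ c → (a ∨ b) ⊑ c) (⊥-min : ∀ a → ⊥ ⊑ a)
    {ℓ : ℕ} (F : Tuple K ℓ → Tuple K ℓ)
    (F-mono : ∀ {x y} → (∀ i → x i ⊑ y i) → ∀ i → F x i ⊑ F y i)
    (F-shift : ∀ x s i → F (λ j → x j ∨ s) i ⊑ (F x i ∨ s))
    where

    ∨-mono : ∀ {a b c d} → a ⊑ b → c ⊑ d → (a ∨ c) ⊑ (b ∨ d)
    ∨-mono p q = lub (⊑-trans p (inl _ _)) (⊑-trans q (inr _ _))

    -- The value obtained from derivation trees of height at most n that use only
    -- variables of V, each at most once on a branch.
    simple : ℕ → Sub.Subset ℓ → Tuple K ℓ
    simple zero    V X = ⊥
    simple (suc n) V X with X Subₚ.∈? V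
    ... | yes _ = F (simple n (V Sub.- X)) X
    ... | no  _ = ⊥

    simple-delete : ∀ n V X Y → simple n (V Sub.- X) Y ⊑ simple n V Y
    simple-delete zero    V X Y = ⊑-refl
    simple-delete (suc n) V X Y with Y Subₚ.∈? (V Sub.- X) | Y Subₚ.∈? V
    ... | no  _ | _       = ⊥-min _
    ... | yes p | no  Y∉V = contradiction (Subₚ.p─q⊆p V _ p) Y∉V
    ... | yes _ | yes _   = F-mono
      (λ Z → ≡.subst (λ W → simple n W Z ⊑ simple n (V Sub.- Y) Z)
                     (Subₚ.p─x─y≡p─y─x V Y X) (simple-delete n (V Sub.- Y) X Z)) Y

    simple-suc : ∀ n V Y → simple n V Y ⊑ simple (suc n) V Y
    simple-suc zero    V Y = ⊥-min _
    simple-suc (suc n) V Y with Y Subₚ.∈? V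
    ... | no  _ = ⊑-refl
    ... | yes _ = F-mono (simple-suc n (V Sub.- Y)) Y

    -- A tree that uses X lies below its subtree at an occurrence of X.
    simple-split : ∀ n V {X} → X Sub.∈ V → ∀ Y →
      simple n V Y ⊑ (simple n (V Sub.- X) Y ∨ simple n V X)
    simple-split n V {X} X∈V Y with Y ≟ X
    ... | yes ≡.refl = inr _ _
    simple-split zero    V {X} X∈V Y | no _ = ⊥-min _
    simple-split (suc n) V {X} X∈V Y | no Y≢X
      with Y Subₚ.∈? V | Y Subₚ.∈? (V Sub.- X) | X Subₚ.∈? V
    ... | no  _   | _   | _ = ⊥-min _
    ... | yes Y∈V | no Y∉V-X | _ = contradiction (Subₚ.x∈p∧x≢y⇒x∈p-y Y∈V Y≢X) Y∉V-X
    ... | yes _ | yes _ | no X∉V = contradiction X∈V X∉V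
    ... | yes Y∈V | yes _ | yes _ =
      -- Each child of the root `Y` is split at `X` by induction; `F-shift` then moves the `X`-part
      -- out of `F`.
      ⊑-trans (F-mono (simple-split n (V Sub.- Y) X∈V-Y) Y)
        (⊑-trans (F-shift _ _ Y)
          (∨-mono (F-mono (λ Z → ≡.subst (λ W → simple n (V Sub.- Y Sub.- X) Z ⊑ simple n W Z)
                                         (Subₚ.p─x─y≡p─y─x V Y X) ⊑-refl) Y)
                  X-part))
      where
        X∈V-Y = Subₚ.x∈p∧x≢y⇒x∈p-y X∈V (Y≢X ∘ ≡.sym)
        -- The subtree at `X` avoids `Y` and is lower than allowed; both restrictions are relaxed.
        X-part : simple n (V Sub.- Y) X ⊑ F (simple n (V Sub.- X)) X
        X-part with simple-suc n (V Sub.- Y) X | simple-delete (suc n) V Y X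
        ... | p | q with X Subₚ.∈? V
        ...   | yes _  = ⊑-trans p q
        ...   | no X∉V = contradiction X∈V X∉V

    -- The new root `X` may recur further down. `simple-split` and `F-shift` separate the trees in
    -- which it does not, which have the right form, from the subtrees at `X`, which can replace the
    -- whole tree.
    simple-step : ∀ n V {X} → X Sub.∈ V → F (simple n V) X ⊑ simple (suc n) V X
    simple-step n V {X} X∈V =
      ⊑-trans (F-mono (simple-split n V X∈V) X)
        (⊑-trans (F-shift _ _ X) (lub head (simple-suc n V X)))
      where
        head : F (simple n (V Sub.- X)) X ⊑ simple (suc n) V X
        head with X Subₚ.∈? V
        ... | yes _  = ⊑-refl
        ... | no X∉V = contradiction X∈V X∉V

    -- A branch without repetition visits at most `∣ V ∣` variables, so a greater height admits no
    -- new trees.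
    simple-saturates : ∀ n V → Sub.∣ V ∣ ℕ.≤ n → ∀ X → simple (suc n) V X ⊑ simple n V X
    simple-saturates n V ∣V∣≤n X with X Subₚ.∈? V
    ... | no _ = ⊥-min _
    simple-saturates zero V ∣V∣≤0 X | yes X∈V =
      contradiction (ℕₚ.<-≤-trans (Subₚ.x∈p⇒∣p-x∣<∣p∣ X∈V) ∣V∣≤0) (λ ())
    simple-saturates (suc n) V ∣V∣≤n X | yes X∈V with X Subₚ.∈? V
    ... | no X∉V = contradiction X∈V X∉V
    ... | yes _  = F-mono (simple-saturates n (V Sub.- X)
      (ℕₚ.≤-pred (ℕₚ.<-≤-trans (Subₚ.x∈p⇒∣p-x∣<∣p∣ X∈V) ∣V∣≤n))) X

    simple⊑iter : ∀ n V X → simple n V X ⊑ iter K F n (λ _ → ⊥) X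
    simple⊑iter zero    V X = ⊑-refl
    simple⊑iter (suc n) V X with X Subₚ.∈? V
    ... | no  _ = ⊥-min _
    ... | yes _ = F-mono (simple⊑iter n (V Sub.- X)) X

    -- The bound is closed under `F`: `simple-step` raises the height by one and `simple-saturates`
    -- lowers it again, as the full set has `ℓ` elements.
    iter⊑simple : ∀ n X → iter K F n (λ _ → ⊥) X ⊑ simple ℓ Sub.⊤ X
    iter⊑simple zero    X = ⊥-min _
    iter⊑simple (suc n) X =
      ⊑-trans (F-mono (iter⊑simple n) X)
        (⊑-trans (simple-step ℓ Sub.⊤ Subₚ.∈⊤)
                 (simple-saturates ℓ Sub.⊤ (ℕₚ.≤-reflexive (Subₚ.∣⊤∣≡n ℓ)) X))

    iter-stabilises : ∀ n X → iter K F n (λ _ → ⊥) X ⊑ iter K F ℓ (λ _ → ⊥) X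
    iter-stabilises n X = ⊑-trans (iter⊑simple n X) (simple⊑iter ℓ Sub.⊤ X)

-- Relations preserved by polynomial evaluation.

-- Ternary so that it also covers the expansion of F at w + s r in terms of F at w and at r.
module LogicalRelation (K : CommutativeSemiring 0ℓ 0ℓ) where

  open CommutativeSemiring K

  module _
    (R : Carrier → Carrier → Carrier → Set)
    (R-const : ∀ c → R c c c)
    (R-+ : ∀ {a b c a′ b′ c′} → R a b c → R a′ b′ c′ → R (a + a′) (b + b′) (c + c′))
    (R-* : ∀ {a b c a′ b′ c′} → R a b c → R a′ b′ c′ → R (a * a′) (b * b′) (c * c′))
    where

    pow-related : ∀ {a b c} → R a b c → ∀ n → R (pow K a n) (pow K b n) (pow K c n)
    pow-related r zero    = R-const 1#
    pow-related r (suc n) = R-* r (pow-related r n)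

    evalMon-related : ∀ {ℓ} (m : Monomial K ℓ) {x y z : Tuple K ℓ} → (∀ i → R (x i) (y i) (z i)) →
      R (evalMon K m x) (evalMon K m y) (evalMon K m z)
    evalMon-related []      r = R-const 1#
    evalMon-related (e ∷ m) r =
      R-* (pow-related (r Fin.zero) e) (evalMon-related m (r ∘ Fin.suc))

    evalPoly-related : ∀ {ℓ} (P : Polynomial K ℓ) {x y z : Tuple K ℓ} → (∀ i → R (x i) (y i) (z i)) →
      R (evalPoly K P x) (evalPoly K P y) (evalPoly K P z)
    evalPoly-related []            r = R-const 0#
    evalPoly-related ((c , m) ∷ P) r =
      R-+ (R-* (R-const c) (evalMon-related m r)) (evalPoly-related P r)

-- Natural order and powers in an absorptive semiring.

module AbsorptiveOrder (K : CommutativeSemiring 0ℓ 0ℓ) (absorptive : Absorptive K) where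

  open CommutativeSemiring K

  open SemiringSolver K using (solve; _:=_; _:+_; _:*_)

  infix 4 _≤_
  _≤_ : Carrier → Carrier → Set
  _≤_ = _≤ₙ_ K

  -- Addition is idempotent: absorption gives `1# + 1# ≈ 1#`, which is multiplied by `b`.
  ≤-reflexive : ∀ {a b} → a ≈ b → a ≤ b
  ≤-reflexive {a} {b} a≈b = begin
    a + b           ≈⟨ +-cong (trans a≈b (sym (*-identityʳ b))) (sym (*-identityʳ b)) ⟩
    b * 1# + b * 1# ≈⟨ distribˡ b 1# 1# ⟨
    b * (1# + 1#)   ≈⟨ *-congˡ (proj₂ absorptive 1#) ⟩
    b * 1#          ≈⟨ *-identityʳ b ⟩
    b               ∎
    where open import Relation.Binary.Reasoning.Setoid setoid

  ≤-trans : ∀ {a b c} → a ≤ b → b ≤ c → a ≤ c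
  ≤-trans {a} {b} {c} p q =
    trans (+-congˡ (sym q)) (trans (sym (+-assoc a b c)) (trans (+-congʳ p) q))

  ≤-antisym : ∀ {a b} → a ≤ b → b ≤ a → a ≈ b
  ≤-antisym {a} {b} p q = trans (sym q) (trans (+-comm b a) p)

  ≤-poset : Poset 0ℓ 0ℓ 0ℓ
  ≤-poset = record
    { Carrier = Carrier ; _≈_ = _≈_ ; _≤_ = _≤_
    ; isPartialOrder = record
      { isPreorder = record
        { isEquivalence = isEquivalence ; reflexive = ≤-reflexive ; trans = ≤-trans }
      ; antisym = ≤-antisym } }

  open PosetReasoning ≤-poset public
  open Poset ≤-poset public using () renaming (refl to ≤-refl)

  0≤ : ∀ a → 0# ≤ a
  0≤ = +-identityˡ

  ≤1 : ∀ a → a ≤ 1#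
  ≤1 a = trans (+-comm a 1#) (proj₂ absorptive a)

  +-mono : ∀ {a b c d} → a ≤ b → c ≤ d → (a + c) ≤ (b + d)
  +-mono {a} {b} {c} {d} p q = trans
    (solve 4 (λ a b c d → (a :+ c) :+ (b :+ d) := (a :+ b) :+ (c :+ d)) refl a b c d)
    (+-cong p q)

  *-monoʳ : ∀ c {a b} → a ≤ b → (c * a) ≤ (c * b)
  *-monoʳ c {a} {b} p = trans (sym (distribˡ c a b)) (*-congˡ p)

  *-mono : ∀ {a b c d} → a ≤ b → c ≤ d → (a * c) ≤ (b * d)
  *-mono {a} {b} {c} {d} p q = begin
    a * c ≤⟨ *-monoʳ a q ⟩
    a * d ≈⟨ *-comm a d ⟩
    d * a ≤⟨ *-monoʳ d p ⟩
    d * b ≈⟨ *-comm d b ⟩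
    b * d ∎

  +-lub : ∀ {a b c} → a ≤ c → b ≤ c → (a + b) ≤ c
  +-lub p q = ≤-trans (+-mono p q) (≤-reflexive ≤-refl)

  a≤a+b : ∀ a b → a ≤ (a + b)
  a≤a+b a b = begin
    a      ≈⟨ +-identityʳ a ⟨
    a + 0# ≤⟨ +-mono ≤-refl (0≤ b) ⟩
    a + b  ∎

  b≤a+b : ∀ a b → b ≤ (a + b)
  b≤a+b a b = ≤-trans (a≤a+b b a) (≤-reflexive (+-comm b a))

  a*b≤a : ∀ a b → (a * b) ≤ a
  a*b≤a a b = ≤-trans (*-monoʳ a (≤1 b)) (≤-reflexive (*-identityʳ a))

  a*b≤b : ∀ a b → (a * b) ≤ b
  a*b≤b a b = ≤-trans (≤-reflexive (*-comm a b)) (a*b≤a b a)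

  pow-+ : ∀ a m n → pow K a (m ℕ.+ n) ≈ (pow K a m * pow K a n)
  pow-+ a zero    n = sym (*-identityˡ _)
  pow-+ a (suc m) n = trans (*-congˡ (pow-+ a m n)) (sym (*-assoc _ _ _))

  pow-antitone : ∀ a {m n} → m ℕ.≤ n → pow K a n ≤ pow K a m
  pow-antitone a z≤n         = ≤1 _
  pow-antitone a (ℕ.s≤s m≤n) = *-monoʳ a (pow-antitone a m≤n)

  pow-* : ∀ a b n → pow K (a * b) n ≤ (pow K a n * pow K b n)
  pow-* a b zero    = ≤-reflexive (sym (*-identityʳ 1#))
  pow-* a b (suc n) = begin
    (a * b) * pow K (a * b) n             ≤⟨ *-monoʳ _ (pow-* a b n) ⟩
    (a * b) * (pow K a n * pow K b n)
      ≈⟨ solve 4 (λ a b c d → (a :* b) :* (c :* d) := (a :* c) :* (b :* d)) refl a b _ _ ⟩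
    (a * pow K a n) * (b * pow K b n)     ∎

  -- Among `m + n` factors taken from `a` and `b`, there are at least `m` times `a` or at least `n`
  -- times `b`; further factors only decrease the product.
  pow-sum : ∀ a b m n → pow K (a + b) (m ℕ.+ n) ≤ (pow K a m + pow K b n)
  pow-sum a b zero    n    = ≤-trans (≤1 _) (a≤a+b _ _)
  pow-sum a b (suc m) zero = ≤-trans (≤1 _) (b≤a+b _ _)
  pow-sum a b (suc m) (suc n) = begin
    (a + b) * pow K (a + b) (m ℕ.+ suc n)  ≈⟨ distribʳ _ a b ⟩
    a * pow K (a + b) (m ℕ.+ suc n) + b * pow K (a + b) (m ℕ.+ suc n)
      ≈⟨ +-congˡ (*-congˡ (reflexive (≡.cong (pow K (a + b)) (ℕₚ.+-suc m n)))) ⟩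
    a * pow K (a + b) (m ℕ.+ suc n) + b * pow K (a + b) (suc m ℕ.+ n)
      ≤⟨ +-mono (*-monoʳ a (pow-sum a b m (suc n))) (*-monoʳ b (pow-sum a b (suc m) n)) ⟩
    a * (pow K a m + pow K b (suc n)) + b * (pow K a (suc m) + pow K b n)
      ≈⟨ +-cong (distribˡ a _ _) (distribˡ b _ _) ⟩
    (a * pow K a m + a * pow K b (suc n)) + (b * pow K a (suc m) + b * pow K b n)
      ≤⟨ +-lub (+-mono ≤-refl (a*b≤b _ _)) (+-mono (a*b≤b _ _) ≤-refl) ⟩
    pow K a (suc m) + pow K b (suc n) ∎

  -- Meets and greatest postfixed points from completeness.

  module _ (complete : IsCompleteLattice K) where

    meet : ∀ a b → ∃ λ c → c ≤ a × c ≤ b × (∀ u → u ≤ a → u ≤ b → u ≤ c)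
    meet a b with proj₂ complete (λ x → x ≡ a ⊎ x ≡ b)
    ... | c , lower , greatest =
      c , lower a (inj₁ ≡.refl) , lower b (inj₂ ≡.refl)
        , λ u u≤a u≤b → greatest u (λ { _ (inj₁ ≡.refl) → u≤a ; _ (inj₂ ≡.refl) → u≤b })

    -- Knaster-Tarski. Completeness concerns subsets of `K`, so the join of all postfixed tuples is
    -- formed entry by entry. It is again postfixed, and so is its image, which therefore lies below
    -- it.
    greatest-postfixed : ∀ {ℓ} (Φ : Tuple K ℓ → Tuple K ℓ) →
      (∀ {x y} → (∀ i → x i ≤ y i) → ∀ i → Φ x i ≤ Φ y i) →
      ∃ λ g → (∀ i → g i ≤ Φ g i) × (∀ i → Φ g i ≤ g i)
            × (∀ u → (∀ i → u i ≤ Φ u i) → ∀ i → u i ≤ g i)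
    greatest-postfixed {ℓ} Φ Φ-mono =
      g , g≤Φg , greatest (Φ g) (Φ-mono g≤Φg) , greatest
      where
        values : Fin ℓ → Subset K
        values i x = ∃ λ (u : Tuple K ℓ) → (∀ j → u j ≤ Φ u j) × x ≡ u i
        g : Tuple K ℓ
        g i = proj₁ (proj₁ complete (values i))
        greatest : ∀ u → (∀ i → u i ≤ Φ u i) → ∀ i → u i ≤ g i
        greatest u u≤Φu i = proj₁ (proj₂ (proj₁ complete (values i))) _ (u , u≤Φu , ≡.refl)
        g≤Φg : ∀ i → g i ≤ Φ g i
        g≤Φg i = proj₂ (proj₂ (proj₁ complete (values i))) _
          λ { _ (u , u≤Φu , ≡.refl) → ≤-trans (u≤Φu i) (Φ-mono (greatest u u≤Φu) i) }

-- The infinitary power.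

module InfinitaryPower (K : CommutativeSemiring 0ℓ 0ℓ)
  (absorptive : Absorptive K) (fc : FullyContinuous K) where

  open CommutativeSemiring K
  open AbsorptiveOrder K absorptive

  infix 9 _^∞
  _^∞ : Carrier → Carrier
  a ^∞ = proj₁ (proj₂ (proj₁ fc) (λ x → ∃ λ n → x ≈ pow K a n))

  ^∞-isInfPow : ∀ a → IsInfPow K a (a ^∞)
  ^∞-isInfPow a = proj₂ (proj₂ (proj₁ fc) (λ x → ∃ λ n → x ≈ pow K a n))

  ^∞≤pow : ∀ a n → a ^∞ ≤ pow K a n
  ^∞≤pow a n = proj₁ (^∞-isInfPow a) _ (n , refl)

  ^∞-greatest : ∀ {a u} → (∀ n → u ≤ pow K a n) → u ≤ a ^∞
  ^∞-greatest u≤ = proj₂ (^∞-isInfPow _) _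
    λ { _ (n , x≈) → ≤-trans (u≤ n) (≤-reflexive (sym x≈)) }

  ^∞≤ : ∀ a → a ^∞ ≤ a
  ^∞≤ a = ≤-trans (^∞≤pow a 1) (≤-reflexive (*-identityʳ a))

  powers-chain : ∀ a → IsNonemptyChain K (λ x → ∃ λ n → x ≈ pow K a n)
  powers-chain a = (1# , 0 , refl) , λ { x y (m , x≈) (n , y≈) →
    [ (λ m≤n → inj₂ (descend y≈ x≈ m≤n)) , (λ n≤m → inj₁ (descend x≈ y≈ n≤m)) ]′ (ℕₚ.≤-total m n) }
    where
      descend : ∀ {x y m n} → x ≈ pow K a n → y ≈ pow K a m → m ℕ.≤ n → x ≤ y
      descend {x} {y} {m} {n} x≈ y≈ m≤n = begin
        x         ≈⟨ x≈ ⟩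
        pow K a n ≤⟨ pow-antitone a m≤n ⟩
        pow K a m ≈⟨ y≈ ⟨
        y         ∎

  module _ {_∘ₒ_ : Carrier → Carrier → Carrier} (cont : ContinuousOp K _∘ₒ_)
    (∘ₒ-cong : ∀ {a b c d} → a ≈ b → c ≈ d → (a ∘ₒ c) ≈ (b ∘ₒ d)) where

    -- The powers of `a` form a chain, so by continuity `c ∘ₒ (a ^∞)` is the infimum of the
    -- `c ∘ₒ pow K a n`.
    ≤-op-^∞ : ∀ {y c} a → (∀ n → y ≤ (c ∘ₒ pow K a n)) → y ≤ (c ∘ₒ (a ^∞))
    ≤-op-^∞ {y} {c} a y≤ =
      proj₂ (proj₂ (cont c _ (powers-chain a)) _ (^∞-isInfPow a)) y
        λ { _ (_ , (n , c′≈) , x≈) →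
            ≤-trans (y≤ n) (≤-reflexive (sym (trans x≈ (∘ₒ-cong refl c′≈)))) }

    ≤-^∞-op-^∞ : (∀ a b → (a ∘ₒ b) ≈ (b ∘ₒ a)) →
      ∀ {y} a b → (∀ m n → y ≤ (pow K a m ∘ₒ pow K b n)) → y ≤ ((a ^∞) ∘ₒ (b ^∞))
    ≤-^∞-op-^∞ comm {y} a b y≤ = ≤-op-^∞ b λ n →
      ≤-trans (≤-op-^∞ a λ m → ≤-trans (y≤ m n) (≤-reflexive (comm _ _))) (≤-reflexive (comm _ _))

  ^∞-+ : ∀ a b → (a + b) ^∞ ≤ a ^∞ + b ^∞
  ^∞-+ a b = ≤-^∞-op-^∞ (proj₁ (proj₂ fc)) +-cong +-comm a b λ m n →
    ≤-trans (^∞≤pow (a + b) (m ℕ.+ n)) (pow-sum a b m n)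

  ^∞-* : ∀ a b → (a * b) ^∞ ≤ a ^∞ * b ^∞
  ^∞-* a b = ≤-^∞-op-^∞ (proj₂ (proj₂ fc)) *-cong *-comm a b λ m n → begin
    (a * b) ^∞                                ≤⟨ ^∞≤pow (a * b) (m ℕ.+ n) ⟩
    pow K (a * b) (m ℕ.+ n)                   ≤⟨ pow-* a b (m ℕ.+ n) ⟩
    pow K a (m ℕ.+ n) * pow K b (m ℕ.+ n)
      ≤⟨ *-mono (pow-antitone a (ℕₚ.m≤m+n m n)) (pow-antitone b (ℕₚ.m≤n+m n m)) ⟩
    pow K a m * pow K b n                     ∎

  ^∞-idem : ∀ a → a ^∞ ≤ a ^∞ * a ^∞
  ^∞-idem a = ≤-^∞-op-^∞ (proj₂ (proj₂ fc)) *-cong *-comm a a λ m n →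
    ≤-trans (^∞≤pow a (m ℕ.+ n)) (≤-reflexive (pow-+ a m n))

  idem≤pow : ∀ {e a} → e ≤ e * e → e ≤ a → ∀ n → e ≤ pow K a n
  idem≤pow e≤ee e≤a zero    = ≤1 _
  idem≤pow e≤ee e≤a (suc n) = ≤-trans e≤ee (*-mono e≤a (idem≤pow e≤ee e≤a n))

  -- Substituting the inequality into itself gives `y ≤ w + pow K p n` for all `n`, starting from
  -- `y ≤ 1#`, as the extra terms `p * w` are absorbed by `w`. Continuity of `_+_` passes to the
  -- infimum.
  ≤-affine⇒≤-^∞ : ∀ {y w} p → y ≤ w + y * p → y ≤ w + p ^∞
  ≤-affine⇒≤-^∞ {y} {w} p y≤ = ≤-op-^∞ (proj₁ (proj₂ fc)) +-cong p unfold
    where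
      unfold : ∀ n → y ≤ w + pow K p n
      unfold zero    = ≤-trans (≤1 y) (b≤a+b _ _)
      unfold (suc n) = begin
        y                         ≤⟨ y≤ ⟩
        w + y * p                 ≤⟨ +-mono ≤-refl (*-mono (unfold n) ≤-refl) ⟩
        w + (w + pow K p n) * p   ≈⟨ +-congˡ (trans (*-comm _ p) (distribˡ p w _)) ⟩
        w + (p * w + pow K p (suc n))
          ≤⟨ +-lub (a≤a+b _ _) (+-mono (a*b≤b p w) ≤-refl) ⟩
        w + pow K p (suc n)       ∎

  -- The preorder `_≼_`.

  infix 4 _≼_
  _≼_ : Carrier → Carrier → Set
  a ≼ b = a ^∞ ≤ b

  ≤⇒≼ : ∀ {a b} → a ≤ b → a ≼ b
  ≤⇒≼ p = ≤-trans (^∞≤ _) p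

  -- The idempotent `a ^∞` lies below every power of whatever it lies below. This makes `_≼_`
  -- transitive.
  ≼⇒^∞≤^∞ : ∀ {a b} → a ≼ b → a ^∞ ≤ b ^∞
  ≼⇒^∞≤^∞ {a} p = ^∞-greatest (idem≤pow (^∞-idem a) p)

  ≼-trans : ∀ {a b c} → a ≼ b → b ≼ c → a ≼ c
  ≼-trans p q = ≤-trans (≼⇒^∞≤^∞ p) q

  ≼-+ : ∀ {a b c d} → a ≼ b → c ≼ d → a + c ≼ b + d
  ≼-+ p q = ≤-trans (^∞-+ _ _) (+-mono p q)

  ≼-* : ∀ {a b c d} → a ≼ b → c ≼ d → a * c ≼ b * d
  ≼-* p q = ≤-trans (^∞-* _ _) (*-mono p q)

  ≼-dup : ∀ a → a ≼ a * a
  ≼-dup a = ≤-trans (^∞≤pow a 2) (*-mono ≤-refl (≤-reflexive (*-identityʳ a)))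

  -- Duplicating `a` is free for `_≼_`, since `a ^∞` lies below `a * a`.
  ≼-glb : ∀ {a b c} → a ≼ b → a ≼ c → a ≼ b * c
  ≼-glb p q = ≼-trans (≼-dup _) (≼-* p q)

-- Compatibility of the polynomial operator with both orders.

module FixedPoints (K : CommutativeSemiring 0ℓ 0ℓ)
  (absorptive : Absorptive K) (fc : FullyContinuous K)
  {ℓ : ℕ} (E : EquationSystem K ℓ) where

  open CommutativeSemiring K
  open AbsorptiveOrder K absorptive
  open InfinitaryPower K absorptive fc
  open SemiringSolver K using (solve; _:=_; _:+_; _:*_)

  infix 4 _≤ᵀ_
  _≤ᵀ_ : Tuple K ℓ → Tuple K ℓ → Set
  _≤ᵀ_ = _≤ᵗ_ K

  F : Tuple K ℓ → Tuple K ℓ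
  F = Op K E

  F-mono : ∀ {x y} → x ≤ᵀ y → F x ≤ᵀ F y
  F-mono x≤y i = LogicalRelation.evalPoly-related K (λ a b _ → a ≤ b)
    (λ _ → ≤-refl) +-mono *-mono (E i) {z = λ _ → 0#} x≤y

  -- In a product `(b + s * c) * (b′ + s * c′)` the mixed terms and the one with `s` twice lie below
  -- `s * (c * c′)`, because `b ≤ c` and `b′ ≤ c′`. The relation therefore carries this comparison
  -- along.
  F-expand : ∀ {w r} s → w ≤ᵀ r → ∀ i → F (λ j → w j + s * r j) i ≤ F w i + s * F r i
  F-expand s w≤r i = proj₁ (LogicalRelation.evalPoly-related K
    (λ a b c → (a ≤ b + s * c) × (b ≤ c))
    (λ c → a≤a+b _ _ , ≤-refl)
    (λ { {_} {b} {c} {_} {b′} {c′} (p , q) (p′ , q′) →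
      ≤-trans (+-mono p p′)
        (≤-reflexive (solve 5 (λ b c b′ c′ s → (b :+ s :* c) :+ (b′ :+ s :* c′)
                                            := (b :+ b′) :+ s :* (c :+ c′)) refl b c b′ c′ s))
      , +-mono q q′ })
    (λ { {a} {b} {c} {a′} {b′} {c′} (p , q) (p′ , q′) → (begin
      a * a′                                 ≤⟨ *-mono p p′ ⟩
      (b + s * c) * (b′ + s * c′)
        ≈⟨ solve 5 (λ b c b′ c′ s → (b :+ s :* c) :* (b′ :+ s :* c′)
             := b :* b′ :+ s :* (b :* c′ :+ (c :* b′ :+ s :* (c :* c′)))) refl b c b′ c′ s ⟩
      b * b′ + s * (b * c′ + (c * b′ + s * (c * c′)))
        ≤⟨ +-mono ≤-refl (*-monoʳ s (+-lub (*-mono q ≤-refl)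
             (+-lub (*-monoʳ c q′) (a*b≤b s _)))) ⟩
      b * b′ + s * (c * c′)                  ∎)
      , *-mono q q′ })
    (E i) (λ j → ≤-refl , w≤r j))

  -- The case `r = ones K` of `F-expand`, in which the factor `F r i` is absorbed by `s`.
  F-shift : ∀ x s i → F (λ j → x j + s) i ≤ F x i + s
  F-shift x s i = begin
    F (λ j → x j + s) i      ≤⟨ F-mono (λ j → +-mono ≤-refl (≤-reflexive (sym (*-identityʳ s)))) i ⟩
    F (λ j → x j + s * 1#) i ≤⟨ F-expand s (λ j → ≤1 (x j)) i ⟩
    F x i + s * F (ones K) i ≤⟨ +-mono ≤-refl (a*b≤a s _) ⟩
    F x i + s                ∎

  -- Each factor of a monomial needs its own copy of `e`; idempotence supplies them, and copies at
  -- coefficients are dropped.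
  F-scale : ∀ {e} → e ≤ e * e → ∀ x i → e * F x i ≤ F (λ j → e * x j) i
  F-scale {e} e≤ee x i = LogicalRelation.evalPoly-related K (λ a b _ → e * a ≤ b)
    (λ c → a*b≤b e c)
    (λ p q → ≤-trans (≤-reflexive (distribˡ e _ _)) (+-mono p q))
    (λ { {a} {_} {_} {a′} p q → ≤-trans (*-mono e≤ee ≤-refl)
      (≤-trans (≤-reflexive (solve 3 (λ e a a′ → (e :* e) :* (a :* a′) := (e :* a) :* (e :* a′))
                                     refl e a a′))
               (*-mono p q)) })
    (E i) {z = λ _ → 0#} (λ j → ≤-refl)

  F-≼-mono : ∀ {x y} → (∀ i → x i ≼ y i) → ∀ i → F x i ≼ F y i
  F-≼-mono x≼y i = LogicalRelation.evalPoly-related K (λ a b _ → a ≼ b)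
    (λ c → ^∞≤ c) ≼-+ ≼-* (E i) {z = λ _ → 0#} x≼y

  -- The counterpart of `F-shift` for the reversed order, with `_*_` as join. At a product, `s`
  -- reaches both factors since `≼-glb` permits duplication.
  F-≼-shift : ∀ x s i → F x i * s ≼ F (λ j → x j * s) i
  F-≼-shift x s i = LogicalRelation.evalPoly-related K (λ a b _ → a * s ≼ b)
    (λ c → ≤⇒≼ (a*b≤a c s))
    (λ p q → ≼-trans (≤⇒≼ (≤-reflexive (distribʳ s _ _))) (≼-+ p q))
    (λ p q → ≼-trans (≼-glb (≤⇒≼ (*-mono (a*b≤a _ _) ≤-refl)) (≤⇒≼ (*-mono (a*b≤b _ _) ≤-refl)))
                     (≼-* p q))
    (E i) {z = λ _ → 0#} (λ j → ^∞≤ _)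

  -- Iteration and the least fixed point.

  module _ {G : Tuple K ℓ → Tuple K ℓ} (G-mono : ∀ {x y} → x ≤ᵀ y → G x ≤ᵀ G y) where

    iter-mono : ∀ n {x y} → x ≤ᵀ y → iter K G n x ≤ᵀ iter K G n y
    iter-mono zero    x≤y = x≤y
    iter-mono (suc n) x≤y = G-mono (iter-mono n x≤y)

    iter-ascending : ∀ {x} → x ≤ᵀ G x → ∀ n → iter K G n x ≤ᵀ iter K G (suc n) x
    iter-ascending p zero    = p
    iter-ascending p (suc n) = G-mono (iter-ascending p n)

    iter-prefixed : ∀ {x} → G x ≤ᵀ x → ∀ n → iter K G n x ≤ᵀ x
    iter-prefixed p zero    i = ≤-refl
    iter-prefixed p (suc n) i = ≤-trans (G-mono (iter-prefixed p n) i) (p i)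

    iter-postfixed : ∀ {x} → x ≤ᵀ G x → ∀ n → x ≤ᵀ iter K G n x
    iter-postfixed p zero    i = ≤-refl
    iter-postfixed p (suc n) i = ≤-trans (p i) (G-mono (iter-postfixed p n) i)

    iter-zeros-bound : (∀ x s i → G (λ j → x j + s) i ≤ G x i + s) →
      ∀ n → iter K G n (zeros K) ≤ᵀ iter K G ℓ (zeros K)
    iter-zeros-bound G-shift = Stabilisation.iter-stabilises K _≤_ _+_ 0#
      ≤-refl ≤-trans a≤a+b b≤a+b +-lub 0≤ G G-mono G-shift

  lfp : IsLeastFixedPoint K F (iter K F ℓ (zeros K))
  -- The iterate at `suc ℓ` is by definition `F` applied to the one at `ℓ`, so its bound is the
  -- prefixed half.
  lfp = (λ i → ≤-antisym (iter-zeros-bound F-mono F-shift (suc ℓ) i)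
                         (iter-ascending F-mono (λ _ → 0≤ _) ℓ i))
      , λ y Fy≈y i → ≤-trans (iter-mono F-mono ℓ (λ j → 0≤ (y j)) i)
                             (iter-prefixed F-mono (λ j → ≤-reflexive (Fy≈y j)) ℓ i)

  -- A fixed point above the infinitary power.

  -- Under ≼ the product is a greatest lower bound, so for the reversed order
  -- iterating F from 1 is again an iteration from the bottom element.
  iter-ones-bound : ∀ n i → iter K F ℓ (ones K) i ≼ iter K F n (ones K) i
  iter-ones-bound = Stabilisation.iter-stabilises K (flip _≼_) _*_ 1#
    (^∞≤ _) (flip ≼-trans) (λ a b → ≤⇒≼ (a*b≤a a b)) (λ a b → ≤⇒≼ (a*b≤b a b))
    ≼-glb (λ a → ≤⇒≼ (≤1 a)) F F-≼-mono F-≼-shift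

  module _ (b : Tuple K ℓ) (b-inf : ∀ i → IsInfPow K (iter K F ℓ (ones K) i) (b i)) where

    ^∞≤b : ∀ i → iter K F ℓ (ones K) i ^∞ ≤ b i
    ^∞≤b i = proj₂ (b-inf i) _ (proj₁ (^∞-isInfPow _))

    b≤^∞ : ∀ i → b i ≤ iter K F ℓ (ones K) i ^∞
    b≤^∞ i = proj₂ (^∞-isInfPow _) _ (proj₁ (b-inf i))

    -- Stationarity under `_≼_` provides one more application of `F`; inside it `F-≼-mono` replaces
    -- the iterate by `b`.
    b-postfixed : b ≤ᵀ F b
    b-postfixed i = ≤-trans (b≤^∞ i) (≼-trans (iter-ones-bound (suc ℓ) i) (F-≼-mono ^∞≤b i))

    z : Tuple K ℓ
    z = iter K F ℓ b

    b≤z : b ≤ᵀ z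
    b≤z = iter-postfixed F-mono b-postfixed ℓ

    z-postfixed : z ≤ᵀ F z
    z-postfixed = iter-ascending F-mono b-postfixed ℓ

    -- The iterates of F from b are interleaved with those of x ↦ F x + b from 0.
    z-prefixed : F z ≤ᵀ z
    z-prefixed i = begin
      F z i                                 ≤⟨ lower (suc ℓ) i ⟩
      iter K G (suc (suc ℓ)) (zeros K) i    ≤⟨ iter-zeros-bound G-mono G-shift (suc (suc ℓ)) i ⟩
      iter K G ℓ (zeros K) i                ≤⟨ upper ℓ i ⟩
      z i                                   ∎
      where
        G : Tuple K ℓ → Tuple K ℓ
        G x i = F x i + b i
        G-mono : ∀ {x y} → x ≤ᵀ y → G x ≤ᵀ G y
        G-mono x≤y i = +-mono (F-mono x≤y i) ≤-refl
        G-shift : ∀ x s i → G (λ j → x j + s) i ≤ G x i + s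
        G-shift x s i = ≤-trans (+-mono (F-shift x s i) ≤-refl)
          (≤-reflexive (solve 3 (λ a s b → (a :+ s) :+ b := (a :+ b) :+ s) refl (F x i) s (b i)))
        -- `G` needs one step from zero to reach `b`, hence the shifted index.
        lower : ∀ n → iter K F n b ≤ᵀ iter K G (suc n) (zeros K)
        lower zero    i = b≤a+b _ _
        lower (suc n) i = ≤-trans (F-mono (lower n) i) (a≤a+b _ _)
        upper : ∀ n → iter K G n (zeros K) ≤ᵀ iter K F n b
        upper zero    i = 0≤ _
        -- The summand `b` is absorbed because `b` is postfixed.
        upper (suc n) i = +-lub (F-mono (upper n) i) (iter-postfixed F-mono b-postfixed (suc n) i)

    postfixed-^∞≤z : ∀ {u} → u ≤ᵀ F u → ∀ i → u i ^∞ ≤ z i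
    postfixed-^∞≤z {u} u≤Fu i = begin
      u i ^∞                   ≤⟨ ≼⇒^∞≤^∞ (≤⇒≼ (iter-postfixed F-mono u≤Fu ℓ i)) ⟩
      iter K F ℓ u i ^∞        ≤⟨ ≼⇒^∞≤^∞ (≤⇒≼ (iter-mono F-mono ℓ (λ j → ≤1 (u j)) i)) ⟩
      iter K F ℓ (ones K) i ^∞ ≤⟨ ^∞≤b i ⟩
      b i                      ≤⟨ b≤z i ⟩
      z i                      ∎

    -- Bounding the greatest postfixed point by variable elimination.

    g : Tuple K ℓ
    g = proj₁ (greatest-postfixed (proj₁ fc) F F-mono)

    g-postfixed : g ≤ᵀ F g
    g-postfixed = proj₁ (proj₂ (greatest-postfixed (proj₁ fc) F F-mono))

    g-prefixed : F g ≤ᵀ g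
    g-prefixed = proj₁ (proj₂ (proj₂ (greatest-postfixed (proj₁ fc) F F-mono)))

    g-greatest : ∀ u → u ≤ᵀ F u → u ≤ᵀ g
    g-greatest = proj₂ (proj₂ (proj₂ (greatest-postfixed (proj₁ fc) F F-mono)))

    -- Variable elimination: on the variables in V, the values of g are bounded by the
    -- least solution above z, the other variables being kept at g.
    g-least : ∀ V x → z ≤ᵀ x → (∀ j → j ∉ V → g j ≤ x j) → (∀ j → j ∈ V → F x j ≤ x j) → g ≤ᵀ x
    g-least []      x z≤x g≤x Fx≤x j = g≤x j (λ ())
    g-least (X ∷ V) x z≤x g≤x Fx≤x =
      g-least V x z≤x g≤x-off-V (λ j j∈V → Fx≤x j (there j∈V))
      where
        -- The meet with `g` keeps `F w ≤ w` on `X ∷ V` and puts `w` below `r`, as `F-expand`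
        -- requires.
        w : Tuple K ℓ
        w j = proj₁ (meet (proj₁ fc) (x j) (g j))
        w≤x : w ≤ᵀ x
        w≤x j = proj₁ (proj₂ (meet (proj₁ fc) (x j) (g j)))
        w≤g : w ≤ᵀ g
        w≤g j = proj₁ (proj₂ (proj₂ (meet (proj₁ fc) (x j) (g j))))
        ≤w : ∀ {u} j → u ≤ x j → u ≤ g j → u ≤ w j
        ≤w j = proj₂ (proj₂ (proj₂ (meet (proj₁ fc) (x j) (g j)))) _
        Fw≤w : ∀ j → j ∈ X ∷ V → F w j ≤ w j
        Fw≤w j j∈ = ≤w j (≤-trans (F-mono w≤x j) (Fx≤x j j∈)) (≤-trans (F-mono w≤g j) (g-prefixed j))

        -- The tuple `r` is the greatest solution for `V` once `X` is set to `1#` and the variables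
        -- outside `X ∷ V` are kept at `g`; it becomes the coefficient of `g X` in the bound `v`.
        Φ : Tuple K ℓ → Tuple K ℓ
        Φ u j with j ≟ X | _∈?_ _≟_ j V
        ... | yes _ | _     = 1#
        ... | no  _ | yes _ = F u j
        ... | no  _ | no  _ = g j
        Φ-mono : ∀ {u v} → u ≤ᵀ v → Φ u ≤ᵀ Φ v
        Φ-mono u≤v j with j ≟ X | _∈?_ _≟_ j V
        ... | yes _ | _     = ≤-refl
        ... | no  _ | yes _ = F-mono u≤v j
        ... | no  _ | no  _ = ≤-refl
        r : Tuple K ℓ
        r = proj₁ (greatest-postfixed (proj₁ fc) Φ Φ-mono)
        r≤Φr : r ≤ᵀ Φ r
        r≤Φr = proj₁ (proj₂ (greatest-postfixed (proj₁ fc) Φ Φ-mono))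
        Φr≤r : Φ r ≤ᵀ r
        Φr≤r = proj₁ (proj₂ (proj₂ (greatest-postfixed (proj₁ fc) Φ Φ-mono)))
        g≤Φg : g ≤ᵀ Φ g
        g≤Φg j with j ≟ X | _∈?_ _≟_ j V
        ... | yes _ | _     = ≤1 _
        ... | no  _ | yes _ = g-postfixed j
        ... | no  _ | no  _ = ≤-refl
        w≤r : w ≤ᵀ r
        w≤r j = ≤-trans (w≤g j) (proj₂ (proj₂ (proj₂ (greatest-postfixed (proj₁ fc) Φ Φ-mono))) g g≤Φg j)
        1≤rX : 1# ≤ r X
        1≤rX with Φr≤r X
        ... | p with X ≟ X
        ...   | yes _  = p
        ...   | no X≢X = contradiction ≡.refl X≢X
        Fr≤r : ∀ j → j ∈ V → F r j ≤ r j
        Fr≤r j j∈V with Φr≤r j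
        ... | p with j ≟ X | _∈?_ _≟_ j V
        -- `X` may occur again in `V`; there `r` is at least `1#`.
        ...   | yes _ | _      = ≤-trans (≤1 _) p
        ...   | no _  | yes _  = p
        ...   | no _  | no j∉V = contradiction j∈V j∉V

        p : Carrier
        p = F r X

        e : Carrier
        e = p ^∞

        v : Tuple K ℓ
        v j = w j + g X * r j
        g≤v : g ≤ᵀ v
        -- Induction on the list, with a bound affine in `g X`; it dominates `g` at `X` because
        -- `r X` is at least `1#`.
        g≤v = g-least V v
          (λ j → ≤-trans (≤w j (z≤x j) (g-greatest z z-postfixed j)) (a≤a+b _ _))
          off-V
          (λ j j∈V → ≤-trans (F-expand (g X) w≤r j)
            (+-mono (Fw≤w j (there j∈V)) (*-monoʳ (g X) (Fr≤r j j∈V))))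
          where
            off-V : ∀ j → j ∉ V → g j ≤ v j
            off-V j j∉V with j ≟ X
            ... | yes ≡.refl = begin
              g X             ≈⟨ *-identityʳ (g X) ⟨
              g X * 1#        ≤⟨ *-monoʳ (g X) 1≤rX ⟩
              g X * r X       ≤⟨ b≤a+b _ _ ⟩
              w X + g X * r X ∎
            ... | no j≢X = ≤-trans
              (≤w j (g≤x j λ { (here j≡X) → j≢X j≡X ; (there j∈V) → j∉V j∈V }) ≤-refl) (a≤a+b _ _)

        gX≤wX+e : g X ≤ w X + e
        gX≤wX+e = ≤-affine⇒≤-^∞ p (begin
          g X             ≤⟨ g-postfixed X ⟩
          F g X           ≤⟨ F-mono g≤v X ⟩
          F v X           ≤⟨ F-expand (g X) w≤r X ⟩
          F w X + g X * p ≤⟨ +-mono (Fw≤w X (here ≡.refl)) ≤-refl ⟩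
          w X + g X * p   ∎)

        -- The part `e * r` is postfixed at `X`, as `e ≤ e * p`, and on the rest of `V` by
        -- `F-scale`; elsewhere it lies below `g`, which is added for this reason.
        u : Tuple K ℓ
        u j = e * r j + g j
        e*r≤u : (λ j → e * r j) ≤ᵀ u
        e*r≤u j = a≤a+b _ _
        g≤u : g ≤ᵀ u
        g≤u j = b≤a+b _ _
        scaled : ∀ j → e * F r j ≤ F u j
        scaled j = ≤-trans (F-scale (^∞-idem p) r j) (F-mono e*r≤u j)
        u-postfixed : u ≤ᵀ F u
        u-postfixed j = +-lub (e*r≤Fu j) (≤-trans (g-postfixed j) (F-mono g≤u j))
          where
            e*r≤Fu : ∀ j → e * r j ≤ F u j
            e*r≤Fu j with r≤Φr j
            ... | q with j ≟ X | _∈?_ _≟_ j V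
            ...   | yes ≡.refl | _ = begin
              e * r X   ≤⟨ a*b≤a e _ ⟩
              e         ≤⟨ ^∞-idem p ⟩
              e * e     ≤⟨ *-monoʳ e (^∞≤ p) ⟩
              e * p     ≤⟨ scaled X ⟩
              F u X     ∎
            ...   | no _ | yes _ = ≤-trans (*-monoʳ e q) (scaled j)
            ...   | no _ | no _  = begin
              e * r j   ≤⟨ a*b≤b e _ ⟩
              r j       ≤⟨ q ⟩
              g j       ≤⟨ g-postfixed j ⟩
              F g j     ≤⟨ F-mono g≤u j ⟩
              F u j     ∎

        e≤wX : e ≤ w X
        e≤wX = ≤w X (≤-trans e≤zX (z≤x X)) (≤-trans e≤zX (g-greatest z z-postfixed X))
          where
            e≤uX : e ≤ u X
            e≤uX = begin
              e         ≈⟨ *-identityʳ e ⟨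
              e * 1#    ≤⟨ *-monoʳ e 1≤rX ⟩
              e * r X   ≤⟨ e*r≤u X ⟩
              u X       ∎
            e≤zX : e ≤ z X
            -- As an idempotent below `u X`, `e` also lies below the infinitary power of `u X`.
            e≤zX = ≤-trans (^∞-greatest (idem≤pow (^∞-idem p) e≤uX)) (postfixed-^∞≤z u-postfixed X)

        g≤x-off-V : ∀ j → j ∉ V → g j ≤ x j
        g≤x-off-V j j∉V with j ≟ X
        ... | yes ≡.refl = ≤-trans gX≤wX+e (≤-trans (+-lub ≤-refl e≤wX) (w≤x X))
        ... | no j≢X = g≤x j λ { (here j≡X) → j≢X j≡X ; (there j∈V) → j∉V j∈V }

    gfp : IsGreatestFixedPoint K F z
    gfp = (λ i → ≤-antisym (z-prefixed i) (z-postfixed i))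
        , λ y Fy≈y i → ≤-trans (g-greatest y (λ j → ≤-reflexive (sym (Fy≈y j))) i) (g≤z i)
      where
        g≤z : g ≤ᵀ z
        -- All variables are eliminated, so the condition off the list is void.
        g≤z = g-least (allFin ℓ) z (λ _ → ≤-refl)
          (λ j j∉ → contradiction (∈-allFin j) j∉) (λ j _ → z-prefixed j)

theorem1 : (K : CommutativeSemiring 0ℓ 0ℓ) → Absorptive K → FullyContinuous K →
    (ℓ : ℕ) → (E : EquationSystem K ℓ) → WellFormedSystem K E →
    IsLeastFixedPoint K (Op K E) (iter K (Op K E) ℓ (zeros K))
    × (∀ (b : Tuple K ℓ) → (∀ i → IsInfPow K (iter K (Op K E) ℓ (ones K) i) (b i)) →
         IsGreatestFixedPoint K (Op K E) (iter K (Op K E) ℓ b))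
theorem1 K absorptive fc ℓ E _ = lfp , gfp
  where open FixedPoints K absorptive fc E
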